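{- Let $P=(X,\prec)$ be an interval order with $X=\{1,\dots,n\}$. The vector $(\ell_1,\dots,\ell_n,\rho_1,\dots,\rho_n)$ is a feasible solution of the linear system (consisting of the following inequalities for all $x,y\in X$) $$ \begin{array}{rcll} \ell_x+\rho_x+1&\leq& \ell_y & \text{if } (x,y) \text{ is a slack zero cover pair},\\ \ell_x&\leq& \ell_y+\rho_y & \text{if } (x,y) \text{ is a sharp pair},\\ -\rho_x&\leq& 0 & \text{if } (x,x) \text{ is a slack zero pair}, \end{array} $$ if and only if $\ell_i\ge 0$ for $1\le i\le n$, and the length vector $(\rho_1,\dots,\rho_n)$ is a feasible solution of the system of all cycle inequalities of the key graph $G_P$.
   Context: A finite (strictly) partially ordered set $P=(X,\prec)$ is an interval order if there are compact real intervals $[\ell_x,r_x]$, $x\in X$, with $\ell_x\le r_x$, such that $x\prec y$ if and only if $r_x<\ell_y$. Interval representations are moreover required to satisfy $r_x+1\le \ell_y$ for all $x\prec y$. The length of the interval of $x$ is $\rho_x=r_x-\ell_x$. A natural representation is one in which all endpoints are non-negative integers. The magnitude $m$ of $P$ is the number of distinct down-sets $D(z)=\{x\in X: x\prec z\}$, $z\in X$. The canonical representation $\{[\ell_x^*,r_x^*]:x\in X\}$ of $P$ is the (unique) natural representation whose set of interval endpoints is $\{0,1,\dots,m-1\}$. For $x,y\in X$: $(x,x)$ is a slack zero pair if $\ell_x^*=r_x^*$; $(x,y)$ is a slack zero cover pair if $\ell_y^*=r_x^*+1$; $(x,y)$ is a sharp pair if $x\ne y$ and $\ell_x^*=r_y^*$.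 The key graph $G_P$ is the directed graph with vertices $\rho_1,\dots,\rho_n$ and with arcs coloured red or blue, each arc being weighted by an inequality: a red loop at $\rho_x$, with weight $-\rho_x\le 0$, if $(x,x)$ is a slack zero pair; a blue arc $\rho_x\to\rho_y$, with weight $\ell_x+\rho_x+1\le \ell_y$, if $(x,y)$ is a slack zero cover pair; a red arc $\rho_x\to\rho_y$, with weight $\ell_x\le\ell_y+\rho_y$, if $(x,y)$ is a sharp pair. The cycle inequality of a directed cycle of $G_P$ (no repeated vertices; a loop counts as a cycle of length one) is the inequality obtained by summing the weights of its arcs; all variables $\ell_x$ cancel, so it involves only the variables $\rho_x$. Explicitly, for a cycle of length at least two it reads $\gamma+\sum_{i\in A}\rho_i\le\sum_{j\in B}\rho_j$, where $\gamma$ is the number of blue arcs of the cycle, $A$ is the set of $s$ such that both cycle arcs at $\rho_s$ (entering and leaving) are blue, and $B$ is the set of $s$ such that both are red; for a loop at $\rho_s$ it reads $0\le\rho_s$.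
   Formalization: As worded the equivalence fails for fixed ℓ (1≺2: ℓ=ρ=0 meets the right side only; ℓ=(−1,0), ρ=0 the left only). Proved instead: any feasible (ℓ,ρ) satisfies all cycle inequalities; if ρ satisfies them, some ℓ≥0 makes (ℓ,ρ) feasible. Reals are generalized to any ordered field. -}

module Defs where

open import Algebra.Bundles using (CommutativeRing)
import Algebra.Definitions.RawMonoid as Multiples
open import Data.Bool using (_≟_)
open import Data.Fin using (Fin)
open import Data.Fin.Subset using (Subset)
open import Data.List using (List; []; _∷_; allFin; deduplicate; foldr; length; map)
open import Data.List.Relation.Unary.Unique.Propositional using (Unique)
open import Data.Nat as ℕ using (ℕ; zero; suc)
open import Data.Product using (_×_; _,_; ∃; ∃₂)
open import Data.Sum using (_⊎_)
open import Data.Vec using (tabulate)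
open import Data.Vec.Properties using (≡-dec)
open import Function.Bundles using (_⇔_)
open import Level using (Level; _⊔_; 0ℓ) renaming (suc to lsuc)
open import Relation.Binary.Core using (Rel)
open import Relation.Binary.Construct.Closure.Transitive using (TransClosure; [_]; _∷_)
import Relation.Binary.Construct.NonStrictToStrict as ToStrict
open import Relation.Binary.Structures using (IsDecStrictPartialOrder; IsTotalOrder)
open import Relation.Binary.PropositionalEquality using (_≡_; _≢_)
open import Relation.Nullary using (¬_; does)

private
  variable
    a c ℓ₁ ℓ₂ : Level
    n : ℕ

-- Scalars: the real numbers are replaced by an arbitrary totally ordered field.

record OrderedField c ℓ₁ ℓ₂ : Set (lsuc (c ⊔ ℓ₁ ⊔ ℓ₂)) where
  infix 4 _≤_ _<_
  field
    commutativeRing : CommutativeRing c ℓ₁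
  open CommutativeRing commutativeRing public
  field
    _≤_          : Rel Carrier ℓ₂
    isTotalOrder : IsTotalOrder _≈_ _≤_
    +-monoˡ-≤    : ∀ z {x y} → x ≤ y → x + z ≤ y + z
    *-nonNeg     : ∀ {x y} → 0# ≤ x → 0# ≤ y → 0# ≤ x * y
    0≉1          : ¬ (0# ≈ 1#)
    inverse      : ∀ x → ¬ (x ≈ 0#) → ∃ λ y → x * y ≈ 1#

  _<_ : Rel Carrier (ℓ₁ ⊔ ℓ₂)
  _<_ = ToStrict._<_ _≈_ _≤_

  sum : List Carrier → Carrier
  sum = foldr _+_ 0#

  fromℕ : ℕ → Carrier
  fromℕ k = Multiples._×_ +-rawMonoid k 1#

-- Interval models, over any ordered carrier, so that real and natural
-- representations share one definition.

record IsIntervalModel {A : Set a} (_≤_ : Rel A ℓ₁) (_<_ : Rel A ℓ₂)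
                       (_≺_ : Rel (Fin n) 0ℓ) (l r : Fin n → A) : Set (ℓ₁ ⊔ ℓ₂) where
  field
    l≤r   : ∀ x → l x ≤ r x
    order : ∀ x y → (x ≺ y) ⇔ (r x < l y)

record IntervalOrder (F : OrderedField c ℓ₁ ℓ₂) (n : ℕ) : Set (lsuc 0ℓ ⊔ c ⊔ ℓ₁ ⊔ ℓ₂) where
  private module F = OrderedField F
  infix 4 _≺_
  field
    _≺_                     : Rel (Fin n) 0ℓ
    isDecStrictPartialOrder : IsDecStrictPartialOrder _≡_ _≺_
    intervals               : ∃₂ λ l r → IsIntervalModel F._≤_ F._<_ _≺_ l r

  open IsDecStrictPartialOrder isDecStrictPartialOrder using () renaming (_<?_ to _≺?_)

  downSet : Fin n → Subset n
  downSet z = tabulate λ x → does (x ≺? z)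

  magnitude : ℕ
  magnitude = length (deduplicate (≡-dec _≟_) (map downSet (allFin n)))

record CanonicalRepresentation {F : OrderedField c ℓ₁ ℓ₂} (P : IntervalOrder F n) : Set where
  open IntervalOrder P
  field
    l* r*     : Fin n → ℕ
    model     : IsIntervalModel ℕ._≤_ ℕ._<_ _≺_ l* r*
    separated : ∀ x y → x ≺ y → r* x ℕ.+ 1 ℕ.≤ l* y
    endpoints : ∀ k → (∃ λ x → k ≡ l* x ⊎ k ≡ r* x) ⇔ (k ℕ.< magnitude)

data Colour : Set where
  red blue : Colour

module KeyGraph {F : OrderedField c ℓ₁ ℓ₂} {P : IntervalOrder F n}
                (C : CanonicalRepresentation P) where
  open OrderedField F using (Carrier; _≤_; _+_; -_; 0#; 1#; sum; fromℕ)
  open CanonicalRepresentation C using (l*; r*)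

  SlackZeroPair : Fin n → Set
  SlackZeroPair x = l* x ≡ r* x

  SlackZeroCoverPair : Fin n → Fin n → Set
  SlackZeroCoverPair x y = l* y ≡ r* x ℕ.+ 1

  SharpPair : Fin n → Fin n → Set
  SharpPair x y = x ≢ y × l* x ≡ r* y

  record Feasible (l ρ : Fin n → Carrier) : Set (c ⊔ ℓ₁ ⊔ ℓ₂) where
    field
      slackZeroCover : ∀ x y → SlackZeroCoverPair x y → l x + ρ x + 1# ≤ l y
      sharp          : ∀ x y → SharpPair x y → l x ≤ l y + ρ y
      slackZero      : ∀ x → SlackZeroPair x → - ρ x ≤ 0#

  -- The vertex ρₓ is identified with x.
  data _⟶_ : Fin n → Fin n → Set where
    loop  : ∀ {x}   → SlackZeroPair x        → x ⟶ x
    cover : ∀ {x y} → SlackZeroCoverPair x y → x ⟶ y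
    sharp : ∀ {x y} → SharpPair x y          → x ⟶ y

  colour : ∀ {x y} → x ⟶ y → Colour
  colour (loop _)  = red
  colour (cover _) = blue
  colour (sharp _) = red

  -- Nonempty directed walks.
  Walk : Fin n → Fin n → Set
  Walk = TransClosure _⟶_

  sources : ∀ {x y} → Walk x y → List (Fin n)
  sources ([_] {x} _)   = x ∷ []
  sources (_∷_ {x} _ w) = x ∷ sources w

  lastColour : ∀ {x y} → Walk x y → Colour
  lastColour [ e ]   = colour e
  lastColour (_ ∷ w) = lastColour w

  record Cycle : Set where
    field
      {base} : Fin n
      walk   : Walk base base
      simple : Unique (sources walk)

  -- For each source of an arc of the walk: the colour of the arc entering it,
  -- the vertex, and the colour of the arc leaving it.  The first argument is
  -- the colour of the arc entering the starting vertex.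
  visits : ∀ {x y} → Colour → Walk x y → List (Colour × Fin n × Colour)
  visits d ([_] {x} e)   = (d , x , colour e) ∷ []
  visits d (_∷_ {x} e w) = (d , x , colour e) ∷ visits (colour e) w

  blueArcs : List (Colour × Fin n × Colour) → ℕ
  blueArcs []                    = zero
  blueArcs ((_ , _ , blue) ∷ vs) = suc (blueArcs vs)
  blueArcs ((_ , _ , red)  ∷ vs) = blueArcs vs

  bothBlue : List (Colour × Fin n × Colour) → List (Fin n)
  bothBlue []                       = []
  bothBlue ((blue , s , blue) ∷ vs) = s ∷ bothBlue vs
  bothBlue (_                 ∷ vs) = bothBlue vs

  bothRed : List (Colour × Fin n × Colour) → List (Fin n)
  bothRed []                     = []
  bothRed ((red , s , red) ∷ vs) = s ∷ bothRed vs
  bothRed (_               ∷ vs) = bothRed vs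

  -- The sum of the arc inequalities around the cycle, after cancellation.
  -- A loop at s is both the entering and the leaving arc of s, and is red, so
  -- the formula then reads 0 ≤ ρ s.
  CycleInequality : (Fin n → Carrier) → Cycle → Set ℓ₂
  CycleInequality ρ κ =
    fromℕ (blueArcs vs) + sum (map ρ (bothBlue vs)) ≤ sum (map ρ (bothRed vs))
    where
    open Cycle κ
    vs : List (Colour × Fin n × Colour)
    vs = visits (lastColour walk) walk

module Submission where

-- Give an arc x ⟶ y of the key graph the weight by which its inequality
-- forces l y to exceed l x: ρ x + 1 for a blue arc, - ρ y for a red one.  The
-- linear system then says exactly that l is a potential, that is,
-- l x + weight ≤ l y for every arc (feasible⇒potential, potential⇒feasible).
-- Around a cycle, the + ρ x of a blue arc leaving x cancels the - ρ x of a
-- red arc entering x.  There remain the terms of the vertices with two blue or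
-- two red cycle arcs, and a 1 for each blue arc, so the cycle inequality says
-- exactly that the total weight of the cycle is at most 0
-- (weight≤0⇒cycleInequality, cycleInequality⇒weight≤0).  The theorem is
-- therefore an instance of the fact that a finite weighted digraph has a
-- potential if and only if none of its cycles has positive weight.
--
-- A potential bounds the weight of every walk from x to y by l y - l x, hence
-- that of every closed walk by 0 (potential⇒closedWalk≤0).
--
-- Conversely, suppose that no cycle has positive weight.  Cutting out the
-- cycles of a walk does not lower its weight, so a walk is no heavier than
-- some path with the same ends, or than 0 if it is closed (shorten).  A path
-- has at most n arcs.  Hence the Bellman-Ford recursion, stopped after n
-- rounds, gives the largest weight h x of any walk starting at x, the empty
-- walk included (heaviest-attained, anyWalk≤heaviest).  Prolonging a heaviest
-- walk from y by an arc x ⟶ y shows weight + h y ≤ h x, so that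
-- l x = max h - h x is a non-negative potential (0≤left, left-potential).

import Algebra.Solver.CommutativeMonoid as CMSolver
import Data.Fin as Fin
open import Data.Fin using (Fin; zero; suc)
open import Data.Fin.Properties using (injective⇒≤)
open import Data.List using (List; []; _∷_; allFin; cartesianProductWith; length; lookup; map)
import Data.List.Extrema as Extrema
open import Data.List.Membership.Propositional using (_∈_; _∉_)
open import Data.List.Membership.Propositional.Properties
  using (∈-allFin; ∈-cartesianProductWith⁺; ∈-cartesianProductWith⁻; ∈-lookup; ∈-map⁺)
open import Data.List.Relation.Binary.Subset.Propositional using (_⊆_)
import Data.List.Relation.Unary.All as All
open import Data.List.Relation.Unary.All.Properties using (¬Any⇒All¬)
open import Data.List.Relation.Unary.Any using (here; there)
open import Data.List.Relation.Unary.Unique.Propositional using (Unique; []; _∷_)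
open import Data.List.Relation.Unary.Unique.Propositional.Properties using (Unique[x∷xs]⇒x∉xs)
import Data.Nat as ℕ
open import Data.Nat using (ℕ; zero; suc; z≤n; s≤s)
open import Data.Product using (_×_; _,_; ∃; ∃₂; proj₁; proj₂)
open import Data.Sum using (_⊎_; inj₁; inj₂)
open import Function using (_∘_)
open import Level using (_⊔_)
open import Relation.Binary.Bundles using (TotalOrder)
open import Relation.Binary.Construct.Closure.Transitive using ([_]; _∷_)
open import Relation.Binary.PropositionalEquality as ≡ using (_≡_)
import Relation.Binary.Reasoning.PartialOrder as PosetReasoning
open import Relation.Nullary using (Dec; yes; no; contradiction)
open import Relation.Nullary.Decidable using (map′)
open import Defs

-- Lists without repetition

lookup-injective : ∀ {a} {A : Set a} {xs : List A} → Unique xs →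
                   ∀ {i j} → lookup xs i ≡ lookup xs j → i ≡ j
lookup-injective (_ ∷ _)   {zero}  {zero}  eq = ≡.refl
lookup-injective u@(_ ∷ _) {zero}  {suc j} eq =
  contradiction (≡.subst (_∈ _) (≡.sym eq) (∈-lookup j)) (Unique[x∷xs]⇒x∉xs u)
lookup-injective u@(_ ∷ _) {suc i} {zero}  eq =
  contradiction (≡.subst (_∈ _) eq (∈-lookup i)) (Unique[x∷xs]⇒x∉xs u)
lookup-injective (_ ∷ u)   {suc i} {suc j} eq = ≡.cong suc (lookup-injective u eq)

Unique⇒length≤n : ∀ {n} {xs : List (Fin n)} → Unique xs → length xs ℕ.≤ n
Unique⇒length≤n u = injective⇒≤ (lookup-injective u)

-- Inequalities in an ordered field

module OrderedFieldProperties {c ℓ₁ ℓ₂} (F : OrderedField c ℓ₁ ℓ₂) where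
  open OrderedField F hiding (_<_; zero)

  totalOrder : TotalOrder c ℓ₁ ℓ₂
  totalOrder = record { isTotalOrder = isTotalOrder }

  open TotalOrder totalOrder public
    using (poset) renaming (refl to ≤-refl; trans to ≤-trans; reflexive to ≤-reflexive)

  open PosetReasoning poset
  open import Algebra.Properties.AbelianGroup +-abelianGroup public
    using (//-rightDividesˡ; //-rightDividesʳ; ∙-cancelʳ)

  +-monoʳ-≤ : ∀ z {x y} → x ≤ y → z + x ≤ z + y
  +-monoʳ-≤ z {x} {y} x≤y = begin
    z + x ≈⟨ +-comm z x ⟩
    x + z ≤⟨ +-monoˡ-≤ z x≤y ⟩
    y + z ≈⟨ +-comm y z ⟩
    z + y ∎

  +-cancelʳ-≤ : ∀ z {x y} → x + z ≤ y + z → x ≤ y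
  +-cancelʳ-≤ z {x} {y} x+z≤y+z = begin
    x             ≈⟨ //-rightDividesʳ z x ⟨
    x + z + - z   ≤⟨ +-monoˡ-≤ (- z) x+z≤y+z ⟩
    y + z + - z   ≈⟨ //-rightDividesʳ z y ⟩
    y             ∎

  -‿cancelˡ : ∀ x y → (- x + x) + y ≈ y
  -‿cancelˡ x y = trans (+-congʳ (-‿inverseˡ x)) (+-identityˡ y)

  x≤y+z⇒x-z≤y : ∀ {x y z} → x ≤ y + z → x + - z ≤ y
  x≤y+z⇒x-z≤y {x} {y} {z} x≤y+z = +-cancelʳ-≤ z (begin
    x + - z + z ≈⟨ //-rightDividesˡ z x ⟩
    x           ≤⟨ x≤y+z ⟩
    y + z       ∎)

  x+z≤y⇒x≤y-z : ∀ {x y z} → x + z ≤ y → x ≤ y + - z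
  x+z≤y⇒x≤y-z {x} {y} {z} x+z≤y = +-cancelʳ-≤ z (begin
    x + z       ≤⟨ x+z≤y ⟩
    y           ≈⟨ //-rightDividesˡ z y ⟨
    y + - z + z ∎)

  x≤0⇒x+y≤y : ∀ {x y} → x ≤ 0# → x + y ≤ y
  x≤0⇒x+y≤y {y = y} x≤0 = ≤-trans (+-monoˡ-≤ y x≤0) (≤-reflexive (+-identityˡ y))

  x≤0⇒y+x≤y : ∀ {x y} → x ≤ 0# → y + x ≤ y
  x≤0⇒y+x≤y {y = y} x≤0 = ≤-trans (+-monoʳ-≤ y x≤0) (≤-reflexive (+-identityʳ y))

  x-z≤y⇒x≤y+z : ∀ {x y z} → x + - z ≤ y → x ≤ y + z
  x-z≤y⇒x≤y+z {x} {y} {z} x-z≤y = begin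
    x           ≈⟨ //-rightDividesˡ z x ⟨
    x + - z + z ≤⟨ +-monoˡ-≤ z x-z≤y ⟩
    y + z       ∎

-- The key graph as a weighted digraph

module WeightedKeyGraph {c ℓ₁ ℓ₂ n} {F : OrderedField c ℓ₁ ℓ₂} {P : IntervalOrder F n}
  (C : CanonicalRepresentation P) (ρ : Fin n → OrderedField.Carrier F) where

  open OrderedField F hiding (_<_; zero)
  open OrderedFieldProperties F
  open CanonicalRepresentation C using (l*; r*)
  open KeyGraph C
  open Cycle
  open import Data.List.Membership.DecPropositional (Fin._≟_ {n}) using (_∈?_)
  open PosetReasoning poset
  open Extrema totalOrder using (max; ⊥≤max; xs≤max; argmax-all)
  open CMSolver +-commutativeMonoid using (solve; _⊜_; _⊕_; id)

  private
    variable
      x y z : Fin n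

  -- The weight of an arc from x to y depends only on its colour and its ends.
  -- A loop at x is red and gets the weight - ρ x, as it should.
  arcWeight : Colour → Fin n → Fin n → Carrier
  arcWeight blue x y = ρ x + 1#
  arcWeight red  x y = - ρ y

  -- The weight of a walk is the sum of the weights of its arcs.
  weight : Walk x y → Carrier
  weight ([_] {x} {y} e)   = arcWeight (colour e) x y
  weight (_∷_ {x} {y} e w) = arcWeight (colour e) x y + weight w

  -- Potentials of the key graph, with respect to the arc weights.
  Potential : (Fin n → Carrier) → Set _
  Potential l = ∀ {x y} (e : x ⟶ y) → l x + arcWeight (colour e) x y ≤ l y

  feasible⇒potential : ∀ {l} → Feasible l ρ → Potential l
  feasible⇒potential f (loop {x} p) = x≤0⇒y+x≤y (Feasible.slackZero f x p)
  feasible⇒potential {l} f (cover {x} {y} p) = begin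
    l x + (ρ x + 1#) ≈⟨ +-assoc (l x) (ρ x) 1# ⟨
    l x + ρ x + 1#   ≤⟨ Feasible.slackZeroCover f x y p ⟩
    l y              ∎
  feasible⇒potential f (sharp {x} {y} p) = x≤y+z⇒x-z≤y (Feasible.sharp f x y p)

  potential⇒feasible : ∀ {l} → Potential l → Feasible l ρ
  potential⇒feasible {l} pot = record
    { slackZeroCover = λ x y p → begin
        l x + ρ x + 1#   ≈⟨ +-assoc (l x) (ρ x) 1# ⟩
        l x + (ρ x + 1#) ≤⟨ pot (cover p) ⟩
        l y              ∎
    ; sharp          = λ x y p → x-z≤y⇒x≤y+z (pot (sharp p))
    ; slackZero      = λ x p → +-cancelʳ-≤ (l x) (begin
        - ρ x + l x ≈⟨ +-comm (- ρ x) (l x) ⟩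
        l x + - ρ x ≤⟨ pot (loop p) ⟩
        l x         ≈⟨ +-identityˡ (l x) ⟨
        0# + l x    ∎)
    }

  potential-walk : ∀ {l} → Potential l → (w : Walk x y) → l x + weight w ≤ l y
  potential-walk pot [ e ] = pot e
  potential-walk {y = y} {l} pot (_∷_ {x} {z} e w) = begin
    l x + (arcWeight (colour e) x z + weight w) ≈⟨ +-assoc (l x) _ (weight w) ⟨
    l x + arcWeight (colour e) x z + weight w   ≤⟨ +-monoˡ-≤ (weight w) (pot e) ⟩
    l z + weight w                              ≤⟨ potential-walk pot w ⟩
    l y                                         ∎

  potential⇒closedWalk≤0 : ∀ {l} → Potential l → (w : Walk x x) → weight w ≤ 0#
  potential⇒closedWalk≤0 {x} {l} pot w = +-cancelʳ-≤ (l x) (begin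
    weight w + l x ≈⟨ +-comm (weight w) (l x) ⟩
    l x + weight w ≤⟨ potential-walk pot w ⟩
    l x            ≈⟨ +-identityˡ (l x) ⟨
    0# + l x       ∎)

  -- Cycle inequalities and weights of cycles

  -- The positive counterpart of the weight of an arc entering x: ρ x if the
  -- arc is red, nothing if it is blue.
  redTerm : Colour → Fin n → Carrier
  redTerm blue _ = 0#
  redTerm red  x = ρ x

  -- The two sides of a cycle inequality.
  blueSide redSide : List (Colour × Fin n × Colour) → Carrier
  blueSide vs = fromℕ (blueArcs vs) + sum (map ρ (bothBlue vs))
  redSide  vs = sum (map ρ (bothRed vs))

  -- For an arbitrary walk the cancellation of the ρ-terms is complete except
  -- at the two ends: at x, the term of the fictitious entering arc of colour
  -- d is counted by visits but not by the weight, and at y it is the converse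
  -- for the last arc.
  weight-visits : ∀ d (w : Walk x y) →
    weight w + (redSide (visits d w) + redTerm (lastColour w) y)
      ≈ redTerm d x + blueSide (visits d w)
  weight-visits {x} {y} d [ e ] with colour e | d
  ... | blue | blue = solve 2 (λ r o → (r ⊕ o) ⊕ (id ⊕ id) ⊜ id ⊕ ((o ⊕ id) ⊕ (r ⊕ id))) refl (ρ x) 1#
  ... | blue | red  = solve 2 (λ r o → (r ⊕ o) ⊕ (id ⊕ id) ⊜ r ⊕ ((o ⊕ id) ⊕ id)) refl (ρ x) 1#
  ... | red  | blue = trans
    (solve 2 (λ n s → n ⊕ (id ⊕ s) ⊜ (n ⊕ s) ⊕ (id ⊕ (id ⊕ id))) refl (- ρ y) (ρ y))
    (-‿cancelˡ (ρ y) _)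
  ... | red  | red  = trans
    (solve 3 (λ n r s → n ⊕ ((r ⊕ id) ⊕ s) ⊜ (n ⊕ s) ⊕ (r ⊕ (id ⊕ id))) refl (- ρ y) (ρ x) (ρ y))
    (-‿cancelˡ (ρ y) _)
  weight-visits {y = y} d (_∷_ {x} {z} e w) with colour e | d | weight-visits (colour e) w
  ... | blue | blue | ih = trans
    (solve 5 (λ r o w b i → ((r ⊕ o) ⊕ w) ⊕ (b ⊕ i) ⊜ (r ⊕ o) ⊕ (w ⊕ (b ⊕ i))) refl
      (ρ x) 1# (weight w) _ _)
    (trans (+-congˡ ih)
      (solve 4 (λ r o g s → (r ⊕ o) ⊕ (id ⊕ (g ⊕ s)) ⊜ id ⊕ ((o ⊕ g) ⊕ (r ⊕ s))) refl
        (ρ x) 1# _ _))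
  ... | blue | red  | ih = trans
    (solve 5 (λ r o w b i → ((r ⊕ o) ⊕ w) ⊕ (b ⊕ i) ⊜ (r ⊕ o) ⊕ (w ⊕ (b ⊕ i))) refl
      (ρ x) 1# (weight w) _ _)
    (trans (+-congˡ ih)
      (solve 4 (λ r o g s → (r ⊕ o) ⊕ (id ⊕ (g ⊕ s)) ⊜ r ⊕ ((o ⊕ g) ⊕ s)) refl
        (ρ x) 1# _ _))
  ... | red  | blue | ih = trans
    (+-assoc _ (weight w) _)
    (trans (+-congˡ ih)
      (trans (solve 3 (λ n r s → n ⊕ (r ⊕ s) ⊜ (n ⊕ r) ⊕ (id ⊕ s)) refl (- ρ z) (ρ z) _)
        (-‿cancelˡ (ρ z) _)))
  ... | red  | red  | ih = trans
    (solve 5 (λ n w r b i → (n ⊕ w) ⊕ ((r ⊕ b) ⊕ i) ⊜ r ⊕ (n ⊕ (w ⊕ (b ⊕ i)))) refl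
      (- ρ z) (weight w) (ρ x) _ _)
    (+-congˡ (trans (+-congˡ ih)
      (trans (sym (+-assoc _ (ρ z) _)) (-‿cancelˡ (ρ z) _))))

  -- Entering a cycle with the colour of its last arc makes the two boundary
  -- terms equal.
  weight-cycle : (κ : Cycle) → let vs = visits (lastColour (walk κ)) (walk κ) in
                 weight (walk κ) + redSide vs ≈ blueSide vs
  weight-cycle κ = ∙-cancelʳ i _ _ (trans (+-assoc _ _ i)
    (trans (weight-visits (lastColour (walk κ)) (walk κ)) (+-comm i _)))
    where i = redTerm (lastColour (walk κ)) (base κ)

  weight≤0⇒cycleInequality : (κ : Cycle) → weight (walk κ) ≤ 0# → CycleInequality ρ κ
  weight≤0⇒cycleInequality κ w≤0 = begin
    blueSide vs                   ≈⟨ weight-cycle κ ⟨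
    weight (walk κ) + redSide vs  ≤⟨ +-monoˡ-≤ (redSide vs) w≤0 ⟩
    0# + redSide vs               ≈⟨ +-identityˡ (redSide vs) ⟩
    redSide vs                    ∎
    where vs = visits (lastColour (walk κ)) (walk κ)

  cycleInequality⇒weight≤0 : (κ : Cycle) → CycleInequality ρ κ → weight (walk κ) ≤ 0#
  cycleInequality⇒weight≤0 κ ineq = +-cancelʳ-≤ (redSide vs) (begin
    weight (walk κ) + redSide vs  ≈⟨ weight-cycle κ ⟩
    blueSide vs                   ≤⟨ ineq ⟩
    redSide vs                    ≈⟨ +-identityˡ (redSide vs) ⟨
    0# + redSide vs               ∎)
    where vs = visits (lastColour (walk κ)) (walk κ)

  -- Paths, and the removal of cycles from walks

  -- A path is a walk without repeated vertices.  The sources are all of its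
  -- vertices but the last.
  IsPath : Walk x y → Set
  IsPath {y = y} w = Unique (sources w) × y ∉ sources w

  ∷-unique : ∀ {xs : List (Fin n)} → x ∉ xs → Unique xs → Unique (x ∷ xs)
  ∷-unique x∉xs u = ¬Any⇒All¬ _ x∉xs ∷ u

  closePath : x ⟶ z → (u : Walk z x) → IsPath u → Cycle
  closePath e u (uniq , x∉u) = record { walk = e ∷ u ; simple = ∷-unique x∉u uniq }

  loopCycle : x ⟶ x → Cycle
  loopCycle e = record { walk = [ e ] ; simple = All.[] ∷ [] }

  -- A walk cut into two paths at one of its inner vertices.
  record Split (w : Walk z y) (x : Fin n) : Set (c ⊔ ℓ₁) where
    field
      prefix       : Walk z x
      suffix       : Walk x y
      prefix-path  : IsPath prefix
      suffix-path  : IsPath suffix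
      prefix⊆      : sources prefix ⊆ sources w
      weight-split : weight w ≈ weight prefix + weight suffix

  split : (w : Walk z y) → IsPath w → x ∈ sources w → x ≡ z ⊎ Split w x
  split [ _ ]   _ (here x≡z) = inj₁ x≡z
  split (_ ∷ _) _ (here x≡z) = inj₁ x≡z
  split (_∷_ {z} {v} e w) (u@(_ ∷ uniq) , y∉) (there x∈w)
    with split w (uniq , y∉ ∘ there) x∈w
  ... | inj₁ ≡.refl = inj₂ record
    { prefix       = [ e ]
    ; suffix       = w
    ; prefix-path  = (All.[] ∷ []) , λ { (here ≡.refl) → Unique[x∷xs]⇒x∉xs u x∈w }
    ; suffix-path  = uniq , y∉ ∘ there
    ; prefix⊆      = λ { (here eq) → here eq }
    ; weight-split = refl
    }
  ... | inj₂ s = inj₂ record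
    { prefix       = e ∷ prefix
    ; suffix       = suffix
    ; prefix-path  = ∷-unique (z∉w ∘ prefix⊆) (proj₁ prefix-path)
                   , λ { (here ≡.refl) → z∉w x∈w ; (there x∈p) → proj₂ prefix-path x∈p }
    ; suffix-path  = suffix-path
    ; prefix⊆      = λ { (here eq) → here eq ; (there p) → there (prefix⊆ p) }
    ; weight-split = trans (+-congˡ weight-split) (sym (+-assoc _ (weight prefix) (weight suffix)))
    }
    where
    open Split s
    z∉w = Unique[x∷xs]⇒x∉xs u

  module _ (cycle≤0 : (κ : Cycle) → weight (walk κ) ≤ 0#) where

    -- An arc e : x ⟶ z in front of a path p from z either prolongs it, or
    -- closes a cycle with the part of p up to x; that cycle can be dropped.
    shorten : (w : Walk x y) →
              (x ≡ y × weight w ≤ 0#) ⊎ ∃ λ (p : Walk x y) → IsPath p × weight w ≤ weight p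
    shorten {x} {y} [ e ] with x Fin.≟ y
    ... | yes ≡.refl = inj₁ (≡.refl , cycle≤0 (loopCycle e))
    ... | no x≢y     = inj₂ ([ e ] , ((All.[] ∷ []) , λ { (here y≡x) → x≢y (≡.sym y≡x) }) , ≤-refl)
    shorten {x} {y} (_∷_ {y = z} e w) with shorten w
    -- The rest of the walk is closed, so that e alone has the right ends.
    ... | inj₁ (≡.refl , w≤0) with shorten [ e ]
    ...   | inj₁ (eq , e≤0)        = inj₁ (eq , ≤-trans (x≤0⇒x+y≤y e≤0) w≤0)
    ...   | inj₂ (p , path , e≤p)  = inj₂ (p , path , ≤-trans (x≤0⇒y+x≤y w≤0) e≤p)
    shorten {x} {y} (_∷_ {y = z} e w) | inj₂ (p , path@(uniq , y∉p) , w≤p) with x Fin.≟ y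
    ... | yes ≡.refl = inj₁ (≡.refl , ≤-trans (+-monoʳ-≤ _ w≤p) (cycle≤0 (closePath e p path)))
    ... | no x≢y with x ∈? sources p
    ...   | no x∉p = inj₂ (e ∷ p
                   , (∷-unique x∉p uniq
                     , λ { (here y≡x) → x≢y (≡.sym y≡x) ; (there y∈p) → y∉p y∈p })
                   , +-monoʳ-≤ _ w≤p)
    ...   | yes x∈p with split p path x∈p
    ...     | inj₁ ≡.refl = inj₂ (p , path
                          , ≤-trans (+-monoʳ-≤ _ w≤p) (x≤0⇒x+y≤y (cycle≤0 (loopCycle e))))
    ...     | inj₂ s = inj₂ (suffix , suffix-path , (begin
      arcWeight (colour e) x z + weight w                         ≤⟨ +-monoʳ-≤ _ w≤p ⟩
      arcWeight (colour e) x z + weight p                         ≈⟨ +-congˡ weight-split ⟩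
      arcWeight (colour e) x z + (weight prefix + weight suffix)  ≈⟨ +-assoc _ _ _ ⟨
      arcWeight (colour e) x z + weight prefix + weight suffix
        ≤⟨ x≤0⇒x+y≤y (cycle≤0 (closePath e prefix prefix-path)) ⟩
      weight suffix                                               ∎))
      where open Split s

  -- Heaviest walks from a vertex

  arc? : ∀ c x y → Dec (∃ λ (e : x ⟶ y) → colour e ≡ c)
  arc? blue x y = map′ (λ p → cover p , ≡.refl) (λ { (cover p , _) → p }) (l* y ℕ.≟ r* x ℕ.+ 1)
  arc? red x y with x Fin.≟ y
  ... | yes ≡.refl = map′ (λ p → loop p , ≡.refl)
    (λ { (loop p , _) → p ; (sharp (x≢x , _) , _) → contradiction ≡.refl x≢x }) (l* x ℕ.≟ r* x)
  ... | no x≢y = map′ (λ p → sharp (x≢y , p) , ≡.refl)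
    (λ { (loop _ , _) → contradiction ≡.refl x≢y ; (sharp (_ , p) , _) → p }) (l* x ℕ.≟ r* y)

  -- The weight gained by going from x to y along an arc of colour c and
  -- collecting m y there.  A missing arc counts as 0, the weight of the empty
  -- walk, which leaves the maximum below unchanged.
  gain : (Fin n → Carrier) → Fin n → Colour → Fin n → Carrier
  gain m x c y with arc? c x y
  ... | yes _ = arcWeight c x y + m y
  ... | no  _ = 0#

  colours : List Colour
  colours = red ∷ blue ∷ []

  ∈-colours : ∀ c → c ∈ colours
  ∈-colours red  = here ≡.refl
  ∈-colours blue = there (here ≡.refl)

  gains : (Fin n → Carrier) → Fin n → List Carrier
  gains m x = cartesianProductWith (gain m x) colours (allFin n)

  -- The largest weight of a walk with at most k arcs that starts at x; the
  -- empty walk counts, with weight 0.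
  heaviest : ℕ → Fin n → Carrier
  heaviest zero    x = 0#
  heaviest (suc k) x = max 0# (gains (heaviest k) x)

  0≤heaviest : ∀ k x → 0# ≤ heaviest k x
  0≤heaviest zero    x = ≤-refl
  0≤heaviest (suc k) x = ⊥≤max 0# (gains (heaviest k) x)

  arc≤heaviest : ∀ k (e : x ⟶ y) → arcWeight (colour e) x y + heaviest k y ≤ heaviest (suc k) x
  arc≤heaviest {x} {y} k e = ≤-trans gain≥ (All.lookup (xs≤max 0# (gains (heaviest k) x))
    (∈-cartesianProductWith⁺ (gain (heaviest k) x) (∈-colours (colour e)) (∈-allFin y)))
    where
    gain≥ : arcWeight (colour e) x y + heaviest k y ≤ gain (heaviest k) x (colour e) y
    gain≥ with arc? (colour e) x y
    ... | yes _  = ≤-refl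
    ... | no ¬e  = contradiction (e , ≡.refl) ¬e

  walk≤heaviest : ∀ k (w : Walk x y) → length (sources w) ℕ.≤ k → weight w ≤ heaviest k x
  walk≤heaviest {y = y} (suc k) ([_] {x} e) _ = begin
    arcWeight (colour e) x y                 ≈⟨ +-identityʳ _ ⟨
    arcWeight (colour e) x y + 0#            ≤⟨ +-monoʳ-≤ _ (0≤heaviest k y) ⟩
    arcWeight (colour e) x y + heaviest k y  ≤⟨ arc≤heaviest k e ⟩
    heaviest (suc k) x                       ∎
  walk≤heaviest (suc k) (e ∷ w) (s≤s le) =
    ≤-trans (+-monoʳ-≤ _ (walk≤heaviest k w le)) (arc≤heaviest k e)

  -- The value v is at most the weight of some walk from x, possibly empty.
  Attained : Fin n → Carrier → Set _
  Attained x v = v ≤ 0# ⊎ ∃₂ λ y (w : Walk x y) → v ≤ weight w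

  heaviest-attained : ∀ k x → Attained x (heaviest k x)
  heaviest-attained zero    x = inj₁ ≤-refl
  heaviest-attained (suc k) x = argmax-all (λ v → v) (inj₁ ≤-refl) (All.tabulate attained)
    where
    attained : ∀ {v} → v ∈ gains (heaviest k) x → Attained x v
    attained v∈ with c , y , _ , _ , ≡.refl ← ∈-cartesianProductWith⁻ (gain (heaviest k) x) colours (allFin n) v∈
      with arc? c x y
    ... | no _ = inj₁ ≤-refl
    ... | yes (e , ≡.refl) with heaviest-attained k y
    ...   | inj₁ h≤0          = inj₂ (y , [ e ] , x≤0⇒y+x≤y h≤0)
    ...   | inj₂ (z , w , h≤) = inj₂ (z , e ∷ w , +-monoʳ-≤ _ h≤)

  module _ (cycle≤0 : (κ : Cycle) → weight (walk κ) ≤ 0#) where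

    -- The number of arcs is no restriction, since a path has at most n.
    anyWalk≤heaviest : (w : Walk x y) → weight w ≤ heaviest n x
    anyWalk≤heaviest {x} w with shorten cycle≤0 w
    ... | inj₁ (_ , w≤0) = ≤-trans w≤0 (0≤heaviest n x)
    ... | inj₂ (p , (uniq , _) , w≤p) =
      ≤-trans w≤p (walk≤heaviest n p (Unique⇒length≤n uniq))

    heaviest-step : (e : x ⟶ y) → arcWeight (colour e) x y + heaviest n y ≤ heaviest n x
    heaviest-step {x} {y} e with heaviest-attained n y
    ... | inj₁ h≤0 = ≤-trans (x≤0⇒y+x≤y h≤0) (anyWalk≤heaviest [ e ])
    ... | inj₂ (z , w , h≤w) = ≤-trans (+-monoʳ-≤ _ h≤w) (anyWalk≤heaviest (e ∷ w))

    -- A non-negative potential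

    -- The largest weight of any walk, the empty ones included.
    top : Carrier
    top = max 0# (map (heaviest n) (allFin n))

    -- The left endpoints.
    left : Fin n → Carrier
    left x = top + - heaviest n x

    0≤left : ∀ x → 0# ≤ left x
    0≤left x = x+z≤y⇒x≤y-z (begin
      0# + heaviest n x ≈⟨ +-identityˡ _ ⟩
      heaviest n x      ≤⟨ All.lookup (xs≤max 0# _) (∈-map⁺ (heaviest n) (∈-allFin x)) ⟩
      top               ∎)

    left-potential : Potential left
    left-potential {x} {y} e = x+z≤y⇒x≤y-z (begin
      top + - h x + a + h y    ≈⟨ +-assoc (top + - h x) a (h y) ⟩
      top + - h x + (a + h y)  ≤⟨ +-monoʳ-≤ _ (heaviest-step e) ⟩
      top + - h x + h x        ≈⟨ //-rightDividesˡ (h x) top ⟩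
      top                      ∎)
      where
      h = heaviest n
      a = arcWeight (colour e) x y

proposition5p3 : ∀ {c ℓ₁ ℓ₂} (F : OrderedField c ℓ₁ ℓ₂) (n : ℕ) (P : IntervalOrder F n) (C : CanonicalRepresentation P) →
    let open OrderedField F
        open KeyGraph C
    in (ρ : Fin n → Carrier) →
       (∀ l → Feasible l ρ → ∀ (κ : Cycle) → CycleInequality ρ κ)
       × ((∀ (κ : Cycle) → CycleInequality ρ κ) → ∃ λ l → (∀ i → 0# ≤ l i) × Feasible l ρ)
proposition5p3 F n P C ρ =
    (λ l feasible κ → weight≤0⇒cycleInequality κ
      (potential⇒closedWalk≤0 (feasible⇒potential feasible) (Cycle.walk κ)))
  , (λ ineq → let cycle≤0 = λ κ → cycleInequality⇒weight≤0 κ (ineq κ) in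
      left cycle≤0 , 0≤left cycle≤0 , potential⇒feasible (left-potential cycle≤0))
  where
  open KeyGraph C
  open WeightedKeyGraph C ρ
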